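{- Let $q$ be a prime power, $\varepsilon\in\{0,1\}$ and $\gamma\in\mathbb{F}_{q^5}^*$. Let $L^\varepsilon_\gamma=L_{W^\varepsilon_\gamma}$ be the $\mathbb{F}_q$-linear set of $\mathrm{PG}(1,q^5)$ defined by \[ W^0_\gamma=\{(x,x^q+\gamma h): x\in\mathbb{F}_{q^5},\ \mathrm{Tr}_{q^5/q}(x)=0,\ h\in\mathbb{F}_q\},\qquad W^1_\gamma=\{(x,x^q+\gamma\,\mathrm{Tr}_{q^5/q}(x)): x\in\mathbb{F}_{q^5}\}. \] Then $L^\varepsilon_\gamma$ has a point of weight two if there exists $\theta\in\mathbb{F}_{q^5}\setminus\mathbb{F}_q$ such that \[ \begin{cases} \mathrm{Tr}_{q^5/q}\bigl(\gamma(\theta^q-\theta)^{q+q^2+q^3+q^4}\bigr)=0,\\ \mathrm{Tr}_{q^5/q}\bigl(\gamma\theta(\theta^q-\theta)^{q+q^2+q^3+q^4}\bigr)=\varepsilon\,\mathrm{N}_{q^5/q}(\theta^q-\theta). \end{cases} \]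
   Context: For an $\mathbb{F}_q$-subspace $U$ of $\mathbb{F}_{q^5}^2$, $L_U=\{\langle \mathbf{u}\rangle_{\mathbb{F}_{q^5}}:\mathbf{u}\in U\setminus\{\mathbf 0\}\}\subseteq\mathrm{PG}(1,q^5)$. The weight of a point $\langle\mathbf v\rangle_{\mathbb{F}_{q^5}}$ of $L_U$ (with respect to $U$) is $\dim_{\mathbb{F}_q}(U\cap\langle\mathbf v\rangle_{\mathbb{F}_{q^5}})$; for $L^\varepsilon_\gamma$ the weight is taken with respect to $W^\varepsilon_\gamma$. $\mathrm{Tr}_{q^5/q}(x)=x+x^q+x^{q^2}+x^{q^3}+x^{q^4}$ and $\mathrm{N}_{q^5/q}(x)=x^{1+q+q^2+q^3+q^4}$. -}

module Defs where

open import Algebra.Bundles using (CommutativeRing; Semiring)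
open import Algebra.Module.Bundles using (LeftModule)
import Algebra.Module.Construct.DirectProduct as DirectProduct
import Algebra.Module.Construct.TensorUnit as TensorUnit
open import Algebra.Morphism.Structures using (module RingMorphisms)
import Algebra.Properties.CommutativeMonoid.Sum as Sum
import Algebra.Definitions.RawSemiring as RawSemiringDefs
open import Data.Fin.Base using (Fin; zero; suc)
open import Data.Nat.Base as ℕ using (ℕ)
open import Data.Nat.Primality using (Prime)
open import Data.Product.Base using (∃-syntax; Σ-syntax; _×_; _,_)
open import Data.Vec.Functional using (Vector)
open import Function.Bundles using (Inverse; _⇔_)
open import Level using (Level; Lift; _⊔_) renaming (suc to lsuc)
open import Relation.Binary.PropositionalEquality.Core using (_≡_)
open import Relation.Binary.PropositionalEquality.Properties using () renaming (setoid to ≡-setoid)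
open import Relation.Nullary.Negation.Core using (¬_)
open import Relation.Unary using (Pred; _∩_) renaming (_∈_ to _∈ᵖ_)

PrimePower : ℕ → Set
PrimePower q = ∃[ p ] ∃[ k ] (Prime p × q ≡ p ℕ.^ ℕ.suc k)

-- A field with exactly n elements, counted up to the setoid equality.
record FiniteField (n : ℕ) (c ℓ : Level) : Set (lsuc (c ⊔ ℓ)) where
  field
    commutativeRing : CommutativeRing c ℓ

  open CommutativeRing commutativeRing public

  field
    1≉0         : ¬ (1# ≈ 0#)
    inverse     : ∀ x → ¬ (x ≈ 0#) → ∃[ y ] (x * y ≈ 1#)
    enumeration : Inverse setoid (≡-setoid (Fin n))

record Embedding {m n : ℕ} {c₁ ℓ₁ c₂ ℓ₂ : Level}
                 (F : FiniteField m c₁ ℓ₁) (K : FiniteField n c₂ ℓ₂) :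
                 Set (c₁ ⊔ ℓ₁ ⊔ c₂ ⊔ ℓ₂) where
  private
    module F = FiniteField F
    module K = FiniteField K
  field
    ι                  : F.Carrier → K.Carrier
    isRingMonomorphism : RingMorphisms.IsRingMonomorphism F.rawRing K.rawRing ι

-- F = 𝔽_q is regarded as a subfield of K = 𝔽_{q^5} through ι.
module LinearSets
  {c₁ ℓ₁ c₂ ℓ₂ : Level} (q : ℕ)
  (F : FiniteField q c₁ ℓ₁) (K : FiniteField (q ℕ.^ 5) c₂ ℓ₂)
  (E : Embedding F K) where

  private
    module F = FiniteField F
  open FiniteField K using (Carrier; _≈_; _+_; _*_; _-_; 0#; ring; semiring) public
  open RawSemiringDefs (Semiring.rawSemiring semiring) using (_^_) renaming (_×_ to _·_) public
  open Embedding E using (ι) public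

  _∈𝔽q : Carrier → Set (c₁ ⊔ ℓ₂)
  x ∈𝔽q = Σ[ a ∈ F.Carrier ] (x ≈ ι a)

  Tr : Carrier → Carrier
  Tr x = x + x ^ q + x ^ (q ℕ.^ 2) + x ^ (q ℕ.^ 3) + x ^ (q ℕ.^ 4)

  N : Carrier → Carrier
  N x = x ^ (1 ℕ.+ q ℕ.+ q ℕ.^ 2 ℕ.+ q ℕ.^ 3 ℕ.+ q ℕ.^ 4)

  K² : LeftModule ring c₂ ℓ₂
  K² = DirectProduct.leftModule TensorUnit.leftModule TensorUnit.leftModule

  open LeftModule K² using (Carrierᴹ; _≈ᴹ_; _*ₗ_; 0ᴹ; +ᴹ-commutativeMonoid) public
  open Sum +ᴹ-commutativeMonoid using (sum) public

  -- 𝔽_q-linear combinations of vectors of K².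
  combination : ∀ {d} → Vector F.Carrier d → Vector Carrierᴹ d → Carrierᴹ
  combination a b = sum (λ i → ι (a i) *ₗ b i)

  LinearlyIndependent : ∀ {d} → Vector Carrierᴹ d → Set (c₁ ⊔ ℓ₁ ⊔ ℓ₂)
  LinearlyIndependent b = ∀ a → combination a b ≈ᴹ 0ᴹ → ∀ i → a i F.≈ F.0#

  Span : ∀ {d} → Vector Carrierᴹ d → Pred Carrierᴹ (c₁ ⊔ ℓ₂)
  Span b v = ∃[ a ] (v ≈ᴹ combination a b)

  -- The subset S is an 𝔽_q-subspace with a basis of d vectors.
  HasDimension : ∀ {s} → Pred Carrierᴹ s → ℕ → Set (c₁ ⊔ ℓ₁ ⊔ c₂ ⊔ ℓ₂ ⊔ s)
  HasDimension S d =
    Σ[ b ∈ Vector Carrierᴹ d ] (LinearlyIndependent b × (∀ v → v ∈ᵖ S ⇔ v ∈ᵖ Span b))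

  ⟨_⟩ : Carrierᴹ → Pred Carrierᴹ (c₂ ⊔ ℓ₂)
  ⟨ v ⟩ w = Σ[ k ∈ Carrier ] (w ≈ᴹ k *ₗ v)

  -- Points of PG(1,q^5), given by representatives; the point itself is
  -- the K-line ⟨ representative ⟩.
  record Point : Set (c₂ ⊔ ℓ₂) where
    field
      representative : Carrierᴹ
      nonzero        : ¬ (representative ≈ᴹ 0ᴹ)

    line : Pred Carrierᴹ (c₂ ⊔ ℓ₂)
    line = ⟨ representative ⟩

  L : ∀ {s} → Pred Carrierᴹ s → Pred Point (c₂ ⊔ ℓ₂ ⊔ s)
  L U P = Σ[ u ∈ Carrierᴹ ]
    (u ∈ᵖ U × ¬ (u ≈ᴹ 0ᴹ) × (∀ w → w ∈ᵖ Point.line P ⇔ w ∈ᵖ ⟨ u ⟩))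

  HasWeight : ∀ {s} → Pred Carrierᴹ s → Point → ℕ → Set (c₁ ⊔ ℓ₁ ⊔ c₂ ⊔ ℓ₂ ⊔ s)
  HasWeight U P = HasDimension (U ∩ Point.line P)

  -- W ε γ is W^ε_γ; the Lift only brings the case ε = 1 to the universe of ε = 0.
  W : Fin 2 → Carrier → Pred Carrierᴹ (c₁ ⊔ c₂ ⊔ ℓ₂)
  W zero       γ v = Σ[ x ∈ Carrier ] Σ[ h ∈ Carrier ]
    (Tr x ≈ 0# × h ∈𝔽q × v ≈ᴹ (x , x ^ q + γ * h))
  W (suc zero) γ v = Lift c₁ (Σ[ x ∈ Carrier ] (v ≈ᴹ (x , x ^ q + γ * Tr x)))

  HasPointOfWeightTwo : ∀ {s} → Pred Carrierᴹ s → Set (c₁ ⊔ ℓ₁ ⊔ c₂ ⊔ ℓ₂ ⊔ s)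
  HasPointOfWeightTwo U = Σ[ P ∈ Point ] (P ∈ᵖ L U × HasWeight U P 2)

{-# OPTIONS --safe #-}
module Submission where

-- Write φ for the q-Frobenius map of K, δ = φ θ - θ and D = N(δ)/δ.  A vector of W^ε_γ has the form
-- (x , φ x + γ h) with h ∈ 𝔽_q and Tr x = ε h.  If u is such a vector, then θ u is again one, with
-- parameter h′, exactly when δ φ x = γ (θ h - h′), Tr x = ε h and Tr (θ x) = ε h′.  Solving the first
-- equation for x, the hypotheses on θ make the second one automatic and turn the third into one
-- homogeneous linear equation in (h , h′) over 𝔽_q, which has a nonzero solution; so ⟨u⟩ has weight
-- at least two.  No point has larger weight: the vectors of W^ε_γ on a given line with h = 0 satisfy
-- φ x = m x for a fixed m, hence form an 𝔽_q-space of dimension at most one.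

open import Defs
open import Algebra.Bundles using (CommutativeMonoid; CommutativeSemiring)
open import Algebra.Morphism.Structures using (module RingMorphisms)
import Algebra.Properties.CommutativeMonoid.Sum as CommutativeMonoidSum
import Algebra.Properties.CommutativeSemiring.Binomial as Binomial
import Algebra.Properties.CommutativeSemiring.Exp as CommutativeSemiringExp
import Algebra.Properties.Group as GroupProperties
import Algebra.Properties.Ring as RingProperties
import Algebra.Properties.Semiring.Mult as SemiringMult
import Algebra.Properties.Semiring.Sum as SemiringSum
import Algebra.Solver.Ring.NaturalCoefficients.Default as SemiringSolver
open import Data.Fin.Base using (Fin; zero; suc; toℕ; fromℕ; inject₁; punchIn)
open import Data.Fin.Properties as Fin using (punchInᵢ≢i; toℕ-fromℕ; toℕ-inject₁; toℕ<n)
open import Data.Nat.Base as ℕ using (ℕ; zero; suc; _!)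
open import Data.Nat.Combinatorics using (_C_; nCn≡1; nCk≡n!/k![n-k]!; k![n∸k]!∣n!)
open import Data.Nat.Divisibility using (_∣_; _∤_; divides; m∣m*n; >⇒∤; ∣1⇒≡1)
open import Data.Nat.DivMod using (m/n*n≡m)
open import Data.Nat.Primality using (Prime; euclidsLemma; ¬prime[0]; ¬prime[1])
import Data.Nat.Properties as ℕ
open import Data.Product.Base using (Σ-syntax; ∃-syntax; _×_; _,_; proj₁; proj₂)
open import Data.Sum.Base using (inj₁; inj₂)
open import Data.Vec.Base using (Vec; []; _∷_; replicate)
open import Data.Vec.Functional using (Vector)
open import Function.Base using (_∘_)
open import Function.Bundles using (Inverse; mk⇔)
import Function.Construct.Composition as Composition
import Function.Construct.Symmetry as Symmetry
open import Function.Properties.Inverse using (Inverse⇒Injection)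
open import Level using (Level; lift; _⊔_)
open import Relation.Binary.Definitions using (Decidable)
open import Relation.Binary.PropositionalEquality.Core as ≡ using (_≡_; _≢_)
import Relation.Binary.Reasoning.Setoid as SetoidReasoning
open import Relation.Nullary.Decidable using (yes; no; via-injection)
open import Relation.Nullary.Negation.Core using (¬_; contradiction)

-- Divisibility of binomial coefficients by a prime.

prime∤! : ∀ {p} → Prime p → ∀ {k} → k ℕ.< p → p ∤ k !
prime∤! pr {zero}  k<p p∣1 = ¬prime[1] (≡.subst Prime (∣1⇒≡1 p∣1) pr)
prime∤! pr {suc k} k<p p∣k! with euclidsLemma (suc k) (k !) pr p∣k!
... | inj₁ p∣1+k = >⇒∤ k<p p∣1+k
... | inj₂ p∣k!′ = prime∤! pr (ℕ.<-trans (ℕ.n<1+n k) k<p) p∣k!′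

-- The prime divides p!, which is the binomial coefficient times k! (p - k)!, and both factorials
-- have arguments below p, so Euclid's lemma leaves only the coefficient.
prime∣C : ∀ {p} → Prime p → ∀ {k} → 0 ℕ.< k → k ℕ.< p → p ∣ p C k
prime∣C {p@(suc p-1)} pr {k} 0<k k<p
  with euclidsLemma (p C k) (k ! ℕ.* (p ℕ.∸ k) !) pr p∣product
  where
  instance _ = k ℕ.!* (p ℕ.∸ k) !≢0
  k≤p = ℕ.<⇒≤ k<p
  p∣product : p ∣ (p C k) ℕ.* (k ! ℕ.* (p ℕ.∸ k) !)
  p∣product = ≡.subst (p ∣_)
    (≡.trans (≡.sym (m/n*n≡m (k![n∸k]!∣n! k≤p)))
             (≡.cong (ℕ._* (k ! ℕ.* (p ℕ.∸ k) !)) (≡.sym (nCk≡n!/k![n-k]! k≤p))))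
    -- `p !` unfolds to `p ℕ.* p-1 !`, which is why `p` is matched as a successor.
    (m∣m*n (p-1 !))
... | inj₁ p∣C = p∣C
... | inj₂ p∣d with euclidsLemma (k !) ((p ℕ.∸ k) !) pr p∣d
...   | inj₁ p∣k! = contradiction p∣k! (prime∤! pr k<p)
...   | inj₂ p∣l! = contradiction p∣l! (prime∤! pr (ℕ.∸-monoʳ-< 0<k (ℕ.<⇒≤ k<p)))
prime∣C {zero} pr = contradiction pr ¬prime[0]

-- Additivity of p-power maps in characteristic p.

module _ {c ℓ : Level} (R : CommutativeSemiring c ℓ) where
  open CommutativeSemiring R hiding (zero)
  open CommutativeSemiringExp R using (_^_; ^-congˡ; ^-assocʳ)
  open SemiringMult semiring using (×-congˡ; ×-congʳ; ×-homo-1; ×-assoc-*; ×1-homo-*) renaming (_×_ to _·_)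
  open SemiringSum semiring using (sum; sum-init-last; sum-cong-≋; sum-replicate-zero)
  open SetoidReasoning setoid

  ∣⇒·≈0 : ∀ {p m} → p · 1# ≈ 0# → p ∣ m → ∀ x → m · x ≈ 0#
  ∣⇒·≈0 {p} {m} p·1≈0 (divides d m≡dp) x = begin
    m · x                ≈⟨ ×-congʳ m (*-identityˡ x) ⟨
    m · (1# * x)         ≈⟨ ×-assoc-* m 1# x ⟨
    (m · 1#) * x         ≈⟨ *-congʳ (×-congˡ m≡dp) ⟩
    ((d ℕ.* p) · 1#) * x      ≈⟨ *-congʳ (×1-homo-* d p) ⟩
    (d · 1#) * (p · 1#) * x   ≈⟨ *-congʳ (trans (*-congˡ p·1≈0) (zeroʳ _)) ⟩
    0# * x                    ≈⟨ zeroˡ x ⟩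
    0#                        ∎

  -- All inner terms of the binomial expansion carry a coefficient divisible by p and vanish. The
  -- index 0 leaves the power of y and the index p that of x.
  ^p-distrib-+ : ∀ {p} → Prime p → p · 1# ≈ 0# → ∀ x y → (x + y) ^ p ≈ x ^ p + y ^ p
  ^p-distrib-+ {zero}      pr = contradiction pr ¬prime[0]
  ^p-distrib-+ {p@(suc m)} pr p·1≈0 x y = begin
    (x + y) ^ p                                      ≈⟨ Binomial.theorem R p x y ⟩
    t zero + sum (t ∘ suc)                           ≈⟨ +-cong first (sum-init-last (t ∘ suc)) ⟩
    y ^ p + (sum (t ∘ suc ∘ inject₁) + t (fromℕ p))  ≈⟨ +-congˡ (+-cong middle last) ⟩
    y ^ p + (0# + x ^ p)                             ≈⟨ +-congˡ (+-identityˡ _) ⟩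
    y ^ p + x ^ p                                    ≈⟨ +-comm _ _ ⟩
    x ^ p + y ^ p                                    ∎
    where
    t = Binomial.binomialTerm R x y p

    first : t zero ≈ y ^ p
    first = trans (×-homo-1 _) (*-identityˡ _)

    middle : sum (t ∘ suc ∘ inject₁) ≈ 0#
    middle = trans (sum-cong-≋ (λ i → ∣⇒·≈0 p·1≈0
      (prime∣C pr (ℕ.s≤s ℕ.z≤n) (ℕ.s<s (≡.subst (ℕ._< m) (≡.sym (toℕ-inject₁ i)) (toℕ<n i)))) _))
      (sum-replicate-zero m)

    last : t (fromℕ p) ≈ x ^ p
    last rewrite toℕ-fromℕ m | nCn≡1 p | ℕ.n∸n≡0 m = trans (×-homo-1 _) (*-identityʳ _)

  ^p^-distrib-+ : ∀ {p} → Prime p → p · 1# ≈ 0# →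
                  ∀ k x y → (x + y) ^ (p ℕ.^ k) ≈ x ^ (p ℕ.^ k) + y ^ (p ℕ.^ k)
  ^p^-distrib-+ pr p·1≈0 zero x y = trans (*-identityʳ _) (sym (+-cong (*-identityʳ x) (*-identityʳ y)))
  ^p^-distrib-+ {p} pr p·1≈0 (suc k) x y = begin
    (x + y) ^ (p ℕ.* p ℕ.^ k)                     ≈⟨ ^-assocʳ (x + y) p (p ℕ.^ k) ⟨
    ((x + y) ^ p) ^ (p ℕ.^ k)                     ≈⟨ ^-congˡ (p ℕ.^ k) (^p-distrib-+ pr p·1≈0 x y) ⟩
    (x ^ p + y ^ p) ^ (p ℕ.^ k)                   ≈⟨ ^p^-distrib-+ pr p·1≈0 k (x ^ p) (y ^ p) ⟩
    (x ^ p) ^ (p ℕ.^ k) + (y ^ p) ^ (p ℕ.^ k)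
      ≈⟨ +-cong (^-assocʳ x p (p ℕ.^ k)) (^-assocʳ y p (p ℕ.^ k)) ⟩
    x ^ (p ℕ.* p ℕ.^ k) + y ^ (p ℕ.* p ℕ.^ k)     ∎

-- Sums with a single nontrivial term.

module _ {c ℓ : Level} (M : CommutativeMonoid c ℓ) where
  open CommutativeMonoid M
  open CommutativeMonoidSum M using (sum; sum-remove; sum-cong-≋; sum-replicate-zero)

  -- Stated for an arbitrary commutative monoid because it serves for products, where the neutral
  -- value is `1#`.
  sum-single : ∀ {n} (t : Vector Carrier n) i → (∀ j → j ≢ i → t j ≈ ε) → sum t ≈ t i
  sum-single {suc n} t i t≈ε = trans (sum-remove {i = i} t)
    (trans (∙-congˡ (trans (sum-cong-≋ (λ j → t≈ε (punchIn i j) (punchInᵢ≢i i j))) (sum-replicate-zero n)))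
           (identityʳ _))

-- Arithmetic in finite fields.

module FiniteFieldProperties {n : ℕ} {c ℓ : Level} (K : FiniteField n c ℓ) where
  open FiniteField K hiding (zero)
  open Inverse enumeration using (to; from; to-cong; strictlyInverseˡ; strictlyInverseʳ)
  open CommutativeSemiringExp commutativeSemiring using (_^_)
  open SemiringMult semiring using (×1-homo-*) renaming (_×_ to _·_)
  open GroupProperties +-group using (∙-cancelˡ; x∙y⁻¹≈ε⇒x≈y)
  open RingProperties ring using (-1*x≈-x)
  open SemiringSolver commutativeSemiring using (solve; _:+_; _:*_; _:=_; con)
  open SetoidReasoning setoid
  private
    module Sum = CommutativeMonoidSum +-commutativeMonoid
    module Product = CommutativeMonoidSum *-commutativeMonoid

  infix 4 _≟_
  _≟_ : Decidable _≈_
  _≟_ = via-injection (Inverse⇒Injection enumeration) Fin._≟_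

  *-cancelˡ-≉0 : ∀ {x y z} → ¬ (x ≈ 0#) → x * y ≈ x * z → y ≈ z
  *-cancelˡ-≉0 {x} {y} {z} x≉0 xy≈xz with x⁻¹ , xx⁻¹≈1 ← inverse x x≉0 = begin
    y              ≈⟨ *-identityˡ y ⟨
    1# * y         ≈⟨ *-congʳ xx⁻¹≈1 ⟨
    x * x⁻¹ * y    ≈⟨ swap y ⟩
    x⁻¹ * (x * y)  ≈⟨ *-congˡ xy≈xz ⟩
    x⁻¹ * (x * z)  ≈⟨ swap z ⟨
    x * x⁻¹ * z    ≈⟨ *-congʳ xx⁻¹≈1 ⟩
    1# * z         ≈⟨ *-identityˡ z ⟩
    z              ∎
    where
    swap : ∀ w → x * x⁻¹ * w ≈ x⁻¹ * (x * w)
    swap w = solve 3 (λ a b d → a :* b :* d := b :* (a :* d)) refl x x⁻¹ w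

  x*y≈0⇒y≈0 : ∀ {x y} → ¬ (x ≈ 0#) → x * y ≈ 0# → y ≈ 0#
  x*y≈0⇒y≈0 x≉0 xy≈0 = *-cancelˡ-≉0 x≉0 (trans xy≈0 (sym (zeroʳ _)))

  *-≉0 : ∀ {x y} → ¬ (x ≈ 0#) → ¬ (y ≈ 0#) → ¬ (x * y ≈ 0#)
  *-≉0 x≉0 y≉0 xy≈0 = y≉0 (x*y≈0⇒y≈0 x≉0 xy≈0)

  ^-≉0 : ∀ m {x} → ¬ (x ≈ 0#) → ¬ (x ^ m ≈ 0#)
  ^-≉0 zero    x≉0 = 1≉0
  ^-≉0 (suc m) x≉0 = *-≉0 x≉0 (^-≉0 m x≉0)

  product-≉0 : ∀ {m} (t : Vector Carrier m) → (∀ i → ¬ (t i ≈ 0#)) → ¬ (Product.sum t ≈ 0#)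
  product-≉0 {zero}  t t≉0 = 1≉0
  product-≉0 {suc m} t t≉0 = *-≉0 (t≉0 zero) (product-≉0 (t ∘ suc) (t≉0 ∘ suc))

  0<n : 0 ℕ.< n
  0<n = ℕ.≤-<-trans ℕ.z≤n (toℕ<n (to 0#))

  -- Sums and products over all elements of a finite field.

  module _ {m ℓ′ : Level} (M : CommutativeMonoid m ℓ′) where
    private module M = CommutativeMonoid M
    open CommutativeMonoidSum M using (sum; sum-permute; sum-cong-≋)

    -- Conjugated by the enumeration, a bijection of the field becomes a permutation of the indices.
    -- It is applied to the translation by 1 and to the dilation by a nonzero x.
    sum-reindex : (σ : Inverse setoid setoid) (f : Carrier → M.Carrier) →
                  (∀ {x y} → x ≈ y → f x M.≈ f y) →
                  sum (f ∘ from) M.≈ sum (f ∘ Inverse.to σ ∘ from)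
    sum-reindex σ f f-cong = M.trans
      (sum-permute (f ∘ from)
        (Composition.inverse (Composition.inverse (Symmetry.inverse enumeration) σ) enumeration))
      (sum-cong-≋ {n} (λ i → f-cong (strictlyInverseʳ (Inverse.to σ (from i)))))

  -- Translation by 1 permutes the field, so the sum S of all elements satisfies S = S + n · 1.
  card·1≈0 : n · 1# ≈ 0#
  card·1≈0 = ∙-cancelˡ (Sum.sum from) (n · 1#) 0# (begin
    Sum.sum from + n · 1#                        ≈⟨ +-congˡ (Sum.sum-replicate n) ⟨
    Sum.sum from + Sum.sum {n} (λ _ → 1#)        ≈⟨ Sum.∑-distrib-+ {n} from (λ _ → 1#) ⟨
    Sum.sum (λ i → from i + 1#)
      ≈⟨ sum-reindex +-commutativeMonoid translation (λ x → x) (λ x≈y → x≈y) ⟨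
    Sum.sum from                                 ≈⟨ +-identityʳ _ ⟨
    Sum.sum from + 0#                            ∎)
    where
    cancels : ∀ {a b} → a + b ≈ 0# → ∀ {x y} → y ≈ x + b → y + a ≈ x
    cancels {a} {b} a+b≈0 {x} {y} y≈x+b = begin
      y + a        ≈⟨ +-congʳ y≈x+b ⟩
      x + b + a    ≈⟨ +-assoc x b a ⟩
      x + (b + a)  ≈⟨ +-congˡ (trans (+-comm b a) a+b≈0) ⟩
      x + 0#       ≈⟨ +-identityʳ x ⟩
      x            ∎

    translation : Inverse setoid setoid
    translation = record
      { to        = _+ 1#
      ; from      = _+ (- 1#)
      ; to-cong   = +-congʳ
      ; from-cong = +-congʳ
      ; inverse   = cancels (-‿inverseʳ 1#) , cancels (-‿inverseˡ 1#)
      }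

  dilation : ∀ x → ¬ (x ≈ 0#) → Inverse setoid setoid
  dilation x x≉0 with x⁻¹ , xx⁻¹≈1 ← inverse x x≉0 = record
    { to        = x *_
    ; from      = x⁻¹ *_
    ; to-cong   = *-congˡ
    ; from-cong = *-congˡ
    ; inverse   = cancels xx⁻¹≈1 , cancels (trans (*-comm x⁻¹ x) xx⁻¹≈1)
    }
    where
    cancels : ∀ {a b} → a * b ≈ 1# → ∀ {x y} → y ≈ b * x → a * y ≈ x
    cancels {a} {b} ab≈1 {x} {y} y≈bx = begin
      a * y        ≈⟨ *-congˡ y≈bx ⟩
      a * (b * x)  ≈⟨ *-assoc a b x ⟨
      a * b * x    ≈⟨ *-congʳ ab≈1 ⟩
      1# * x       ≈⟨ *-identityˡ x ⟩
      x            ∎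

  -- Compare the product of the nonzero elements with the product of their multiples by x;
  -- the factor x missing at the element 0 is supplied by "atZero x".
  private
    unitPart : Carrier → Carrier
    unitPart y with y ≟ 0#
    ... | yes _ = 1#
    ... | no  _ = y

    atZero : Carrier → Carrier → Carrier
    atZero x y with y ≟ 0#
    ... | yes _ = x
    ... | no  _ = 1#

    unitPart-cong : ∀ {x y} → x ≈ y → unitPart x ≈ unitPart y
    unitPart-cong {x} {y} x≈y with x ≟ 0# | y ≟ 0#
    ... | yes _   | yes _   = refl
    ... | no  _   | no  _   = x≈y
    ... | yes x≈0 | no  y≉0 = contradiction (trans (sym x≈y) x≈0) y≉0
    ... | no  x≉0 | yes y≈0 = contradiction (trans x≈y y≈0) x≉0

    unitPart-≉0 : ∀ y → ¬ (unitPart y ≈ 0#)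
    unitPart-≉0 y with y ≟ 0#
    ... | yes _   = 1≉0
    ... | no  y≉0 = y≉0

    unitPart-dilation : ∀ {x} → ¬ (x ≈ 0#) → ∀ y → unitPart (x * y) * atZero x y ≈ x * unitPart y
    unitPart-dilation {x} x≉0 y with y ≟ 0# | x * y ≟ 0#
    ... | yes _   | yes _    = *-comm 1# x
    ... | no  _   | no  _    = *-identityʳ _
    ... | yes y≈0 | no  xy≉0 = contradiction (trans (*-congˡ y≈0) (zeroʳ x)) xy≉0
    ... | no  y≉0 | yes xy≈0 = contradiction xy≈0 (*-≉0 x≉0 y≉0)

    product-atZero : ∀ x → Product.sum (atZero x ∘ from) ≈ x
    product-atZero x = trans (sum-single *-commutativeMonoid (atZero x ∘ from) (to 0#) elsewhere) there
      where
      elsewhere : ∀ j → j ≢ to 0# → atZero x (from j) ≈ 1#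
      elsewhere j j≢ with from j ≟ 0#
      ... | yes eq = contradiction (≡.trans (≡.sym (strictlyInverseˡ j)) (to-cong eq)) j≢
      ... | no  _  = refl
      there : atZero x (from (to 0#)) ≈ x
      there with from (to 0#) ≟ 0#
      ... | yes _  = refl
      ... | no ne = contradiction (strictlyInverseʳ 0#) ne

  -- For nonzero x the comparison gives P x = x^n P, and P is nonzero, hence cancels. Each of the n
  -- indices contributes a factor x on the right, including that of 0, where `unitPart` is 1; so the
  -- exponent is n and not n - 1.
  x^card≈x : ∀ x → x ^ n ≈ x
  x^card≈x x with x ≟ 0#
  ... | yes x≈0 = zero-case 0<n
    where
    zero-case : ∀ {m} → 0 ℕ.< m → x ^ m ≈ x
    zero-case {suc m} _ = trans (*-congʳ x≈0) (trans (zeroˡ _) (sym x≈0))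
  ... | no x≉0 = sym (*-cancelˡ-≉0 (product-≉0 (unitPart ∘ from) (unitPart-≉0 ∘ from)) (begin
    P * x
      ≈⟨ *-cong (sum-reindex *-commutativeMonoid (dilation x x≉0) unitPart unitPart-cong) (sym (product-atZero x)) ⟩
    Product.sum (unitPart ∘ (x *_) ∘ from) * Product.sum (atZero x ∘ from)
      ≈⟨ Product.∑-distrib-+ (unitPart ∘ (x *_) ∘ from) (atZero x ∘ from) ⟨
    Product.sum (λ i → unitPart (x * from i) * atZero x (from i))
      ≈⟨ Product.sum-cong-≋ (unitPart-dilation x≉0 ∘ from) ⟩
    Product.sum (λ i → x * unitPart (from i))
      ≈⟨ Product.∑-distrib-+ (λ _ → x) (unitPart ∘ from) ⟩
    Product.sum {n} (λ _ → x) * P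
      ≈⟨ *-congʳ (Product.sum-replicate n) ⟩
    x ^ n * P
      ≈⟨ *-comm _ _ ⟩
    P * x ^ n ∎))
    where P = Product.sum (unitPart ∘ from)

  1<n : 1 ℕ.< n
  1<n = go n (to 0#) (to 1#) (λ eq → 1≉0 (begin
      1#           ≈⟨ strictlyInverseʳ 1# ⟨
      from (to 1#) ≡⟨ ≡.cong from eq ⟨
      from (to 0#) ≈⟨ strictlyInverseʳ 0# ⟩
      0#           ∎))
    where
    go : ∀ m (i j : Fin m) → i ≢ j → 1 ℕ.< m
    go (suc zero)    zero zero i≢j = contradiction ≡.refl i≢j
    go (suc (suc m)) i    j    i≢j = ℕ.s≤s (ℕ.s≤s ℕ.z≤n)

  -- The k-th power of p · 1 is p^k · 1 = n · 1 = 0, and a field has no zero divisors.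
  p^k≡card⇒p·1≈0 : ∀ p k → p ℕ.^ k ≡ n → p · 1# ≈ 0#
  p^k≡card⇒p·1≈0 p k p^k≡n with p · 1# ≟ 0#
  ... | yes p·1≈0 = p·1≈0
  ... | no  p·1≉0 = contradiction (≡.subst (λ m → m · 1# ≈ 0#) (≡.sym p^k≡n) card·1≈0) (power-≉0 k)
    where
    power-≉0 : ∀ k → ¬ ((p ℕ.^ k) · 1# ≈ 0#)
    power-≉0 zero    1·1≈0 = 1≉0 (trans (sym (+-identityʳ 1#)) 1·1≈0)
    power-≉0 (suc k) eq    = *-≉0 p·1≉0 (power-≉0 k) (trans (sym (×1-homo-* p (p ℕ.^ k))) eq)

  -- Polynomials over a finite field and their roots.

  -- The monic polynomial of degree m with the given lower coefficients, constant term first.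
  eval : ∀ {m} → Vec Carrier m → Carrier → Carrier
  eval []       x = 1#
  eval (a ∷ as) x = a + x * eval as x

  -- Synthetic division by x - r: the coefficients of the quotient are the values at r of the
  -- successive tails.
  quotient : ∀ {m} → Vec Carrier (suc m) → Carrier → Vec Carrier m
  quotient (a ∷ [])         r = []
  quotient (a ∷ as@(_ ∷ _)) r = eval as r ∷ quotient as r

  -- x - r is represented by any d with x ≈ d + r, so that only semiring identities are needed.
  eval-quotient : ∀ {m} (as : Vec Carrier (suc m)) r {x d} → x ≈ d + r →
                  eval as x ≈ d * eval (quotient as r) x + eval as r
  eval-quotient (a ∷ []) r {x} {d} x≈d+r = begin
    a + x * 1#             ≈⟨ +-congˡ (*-congʳ x≈d+r) ⟩
    a + (d + r) * 1#
      ≈⟨ solve 3 (λ a d r → a :+ (d :+ r) :* con 1 := d :* con 1 :+ (a :+ r :* con 1)) refl a d r ⟩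
    d * 1# + (a + r * 1#)  ∎
  eval-quotient (a ∷ as@(_ ∷ _)) r {x} {d} x≈d+r = begin
    a + x * eval as x             ≈⟨ +-congˡ (*-congˡ (eval-quotient as r x≈d+r)) ⟩
    a + x * (d * Q + e)
      ≈⟨ solve 5 (λ a x d Q e → a :+ x :* (d :* Q :+ e) := a :+ x :* (d :* Q) :+ x :* e) refl a x d Q e ⟩
    a + x * (d * Q) + x * e       ≈⟨ +-congˡ (*-congʳ x≈d+r) ⟩
    a + x * (d * Q) + (d + r) * e
      ≈⟨ solve 6 (λ a x d r Q e → a :+ x :* (d :* Q) :+ (d :+ r) :* e
           := d :* (e :+ x :* Q) :+ (a :+ r :* e)) refl a x d r Q e ⟩
    d * (e + x * Q) + (a + r * e) ∎
    where
    Q = eval (quotient as r) x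
    e = eval as r

  quotient-root : ∀ {m} (as : Vec Carrier (suc m)) {r y} → eval as r ≈ 0# → ¬ (y ≈ r) →
                  eval as y ≈ 0# → eval (quotient as r) y ≈ 0#
  quotient-root as {r} {y} r-root y≉r y-root = x*y≈0⇒y≈0 (y≉r ∘ x∙y⁻¹≈ε⇒x≈y y r) (begin
    d * Q              ≈⟨ +-identityʳ _ ⟨
    d * Q + 0#         ≈⟨ +-congˡ r-root ⟨
    d * Q + eval as r  ≈⟨ eval-quotient as r y≈d+r ⟨
    eval as y          ≈⟨ y-root ⟩
    0#                 ∎)
    where
    d = y - r
    Q = eval (quotient as r) y
    y≈d+r : y ≈ d + r
    y≈d+r = sym (trans (+-assoc _ _ _) (trans (+-congˡ (-‿inverseˡ _)) (+-identityʳ y)))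

  -- Induction on the degree: after division by the first listed root, the other listed roots and
  -- any further root x remain roots of the quotient. In degree 0 the polynomial is 1 and has no
  -- root.
  root-listed : ∀ {m} (as : Vec Carrier m) (r : Vector Carrier m) →
                (∀ {i j} → r i ≈ r j → i ≡ j) → (∀ i → eval as (r i) ≈ 0#) →
                ∀ x → eval as x ≈ 0# → ∃[ i ] x ≈ r i
  root-listed {zero}  []  r inj roots x 1≈0 = contradiction 1≈0 1≉0
  root-listed {suc m} as r inj roots x root with x ≟ r zero
  ... | yes x≈r₀ = zero , x≈r₀
  ... | no  x≉r₀ =
    let i , x≈rᵢ = root-listed (quotient as (r zero)) (r ∘ suc) (Fin.suc-injective ∘ inj)
                     (λ i → quotient-root as (roots zero) (λ eq → contradiction (inj eq) λ ()) (roots (suc i)))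
                     x (quotient-root as (roots zero) x≉r₀ root)
    in suc i , x≈rᵢ

  ^-fixed-listed : ∀ {m} → 1 ℕ.< m → (r : Vector Carrier m) →
                   (∀ {i j} → r i ≈ r j → i ≡ j) → (∀ i → r i ^ m ≈ r i) →
                   ∀ x → x ^ m ≈ x → ∃[ i ] x ≈ r i
  ^-fixed-listed {suc zero}    (ℕ.s≤s ())
  ^-fixed-listed {suc (suc m)} _ r inj fixed x x-fixed =
    root-listed xᵐ-x r inj (isRoot ∘ fixed) x (isRoot x-fixed)
    where
    -- The leading coefficient 1 is implicit in `eval`. The degree must be at least two, so that the
    -- linear term with coefficient -1 lies below the leading one.
    xᵐ-x = 0# ∷ - 1# ∷ replicate m 0#

    eval-replicate : ∀ k y → eval (replicate k 0#) y ≈ y ^ k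
    eval-replicate zero    y = refl
    eval-replicate (suc k) y = trans (+-identityˡ _) (*-congˡ (eval-replicate k y))

    isRoot : ∀ {y} → y ^ suc (suc m) ≈ y → eval xᵐ-x y ≈ 0#
    isRoot {y} y-fixed = begin
      0# + y * (- 1# + y * eval (replicate m 0#) y) ≈⟨ +-identityˡ _ ⟩
      y * (- 1# + y * eval (replicate m 0#) y)      ≈⟨ *-congˡ (+-congˡ (*-congˡ (eval-replicate m y))) ⟩
      y * (- 1# + y * y ^ m)                        ≈⟨ distribˡ _ _ _ ⟩
      y * - 1# + y * (y * y ^ m)                    ≈⟨ +-cong (trans (*-comm _ _) (-1*x≈-x y)) y-fixed ⟩
      - y + y                                       ≈⟨ -‿inverseˡ y ⟩
      0#                                            ∎

-- The q-Frobenius map of K and its fixed field.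

module FrobeniusProperties
  {c₁ ℓ₁ c₂ ℓ₂ : Level} (q : ℕ) (primePower : PrimePower q)
  (F : FiniteField q c₁ ℓ₁) (K : FiniteField (q ℕ.^ 5) c₂ ℓ₂) (E : Embedding F K) where

  open FiniteField K hiding (zero)
  open FiniteFieldProperties K using (x^card≈x; *-cancelˡ-≉0; ^-≉0; ^-fixed-listed; p^k≡card⇒p·1≈0)
  open LinearSets q F K E using (ι; _∈𝔽q; Tr; N)
  open CommutativeSemiringExp commutativeSemiring using (_^_; ^-congˡ; ^-assocʳ; ^-homo-*; ^-distrib-*)
  open GroupProperties +-group using (inverseˡ-unique)
  open SemiringSolver commutativeSemiring using (solve; _:+_; _:*_; _:=_)
  open SetoidReasoning setoid
  private
    module F where
      open FiniteField F public
      open FiniteFieldProperties F public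
      open CommutativeSemiringExp (FiniteField.commutativeSemiring F) public using (_^_)

  open RingMorphisms.IsRingMonomorphism (Embedding.isRingMonomorphism E) public
    using ()
    renaming (⟦⟧-cong to ι-cong; injective to ι-injective; 1#-homo to ι-1; 0#-homo to ι-0; *-homo to ι-*)

  φ : Carrier → Carrier
  φ x = x ^ q

  φ-cong : ∀ {x y} → x ≈ y → φ x ≈ φ y
  φ-cong = ^-congˡ q

  φ-+ : ∀ x y → φ (x + y) ≈ φ x + φ y
  φ-+ = ≡.subst (λ r → ∀ x y → (x + y) ^ r ≈ x ^ r + y ^ r) (≡.sym q≡p^k)
    -- The characteristic of K is read off from its order, the 5k-th power of p.
    (^p^-distrib-+ commutativeSemiring pr (p^k≡card⇒p·1≈0 p (k ℕ.* 5) p^5k≡q^5) k)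
    where
    p = proj₁ primePower
    k = suc (proj₁ (proj₂ primePower))
    pr = proj₁ (proj₂ (proj₂ primePower))
    q≡p^k = proj₂ (proj₂ (proj₂ primePower))
    p^5k≡q^5 : p ℕ.^ (k ℕ.* 5) ≡ q ℕ.^ 5
    p^5k≡q^5 = ≡.trans (≡.sym (ℕ.^-*-assoc p k 5)) (≡.cong (ℕ._^ 5) (≡.sym q≡p^k))

  φ-* : ∀ x y → φ (x * y) ≈ φ x * φ y
  φ-* x y = ^-distrib-* x y q

  φ-≉0 : ∀ {x} → ¬ (x ≈ 0#) → ¬ (φ x ≈ 0#)
  φ-≉0 = ^-≉0 q

  ^q^suc : ∀ k x → x ^ (q ℕ.^ suc k) ≈ φ (x ^ (q ℕ.^ k))
  ^q^suc k x = trans (reflexive (≡.cong (x ^_) (ℕ.*-comm q (q ℕ.^ k)))) (sym (^-assocʳ x (q ℕ.^ k) q))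

  ^q^2 : ∀ x → x ^ (q ℕ.^ 2) ≈ φ (φ x)
  ^q^2 x = trans (^q^suc 1 x) (φ-cong (reflexive (≡.cong (x ^_) (ℕ.*-identityʳ q))))

  ^q^3 : ∀ x → x ^ (q ℕ.^ 3) ≈ φ (φ (φ x))
  ^q^3 x = trans (^q^suc 2 x) (φ-cong (^q^2 x))

  ^q^4 : ∀ x → x ^ (q ℕ.^ 4) ≈ φ (φ (φ (φ x)))
  ^q^4 x = trans (^q^suc 3 x) (φ-cong (^q^3 x))

  -- This is the identity x^n = x for the order n = q^5 of K. It makes the fourth iterate of φ the
  -- inverse of φ.
  φ⁵≈id : ∀ x → φ (φ (φ (φ (φ x)))) ≈ x
  φ⁵≈id x = trans (sym (trans (^q^suc 4 x) (φ-cong (^q^4 x)))) (x^card≈x x)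

  -- An equational substitute for membership in 𝔽_q, to which it is equivalent by `∈𝔽q⇒fixed` and
  -- `fixed⇒∈𝔽q`. Closure under the field operations then follows from φ being a homomorphism.
  Fixed : Carrier → Set ℓ₂
  Fixed x = φ x ≈ x

  Fixed-resp : ∀ {x y} → x ≈ y → Fixed x → Fixed y
  Fixed-resp x≈y fx = trans (φ-cong (sym x≈y)) (trans fx x≈y)

  Fixed-* : ∀ {x y} → Fixed x → Fixed y → Fixed (x * y)
  Fixed-* fx fy = trans (φ-* _ _) (*-cong fx fy)

  Fixed-+ : ∀ {x y} → Fixed x → Fixed y → Fixed (x + y)
  Fixed-+ fx fy = trans (φ-+ _ _) (+-cong fx fy)

  -- Used with a product equal to 1, to see that the inverse of a fixed element is fixed.
  Fixed-cofactor : ∀ {x y} → ¬ (x ≈ 0#) → Fixed x → Fixed (x * y) → Fixed y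
  Fixed-cofactor {x} {y} x≉0 fx fxy = *-cancelˡ-≉0 x≉0 (begin
    x * φ y    ≈⟨ *-congʳ fx ⟨
    φ x * φ y  ≈⟨ φ-* x y ⟨
    φ (x * y)  ≈⟨ fxy ⟩
    x * y      ∎)

  ι-^ : ∀ m a → ι a ^ m ≈ ι (a F.^ m)
  ι-^ zero    a = sym ι-1
  ι-^ (suc m) a = trans (*-congˡ (ι-^ m a)) (sym (ι-* a _))

  ι-fixed : ∀ a → Fixed (ι a)
  ι-fixed a = trans (ι-^ q a) (ι-cong (F.x^card≈x a))

  ∈𝔽q⇒fixed : ∀ {x} → x ∈𝔽q → Fixed x
  ∈𝔽q⇒fixed (a , x≈ιa) = Fixed-resp (sym x≈ιa) (ι-fixed a)

  -- The images of the q elements of F are q distinct roots of x^q - x, a polynomial of degree q, so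
  -- they are all of its roots.
  fixed⇒∈𝔽q : ∀ {x} → Fixed x → x ∈𝔽q
  fixed⇒∈𝔽q {x} fx =
    let i , x≈ = ^-fixed-listed F.1<n (ι ∘ from) (from-injective ∘ ι-injective) (ι-fixed ∘ from) x fx
    in from i , x≈
    where
    open Inverse F.enumeration using (to; from; to-cong; strictlyInverseˡ)
    from-injective : ∀ {i j} → from i F.≈ from j → i ≡ j
    from-injective {i} {j} eq =
      ≡.trans (≡.sym (strictlyInverseˡ i)) (≡.trans (to-cong eq) (strictlyInverseˡ j))

  Fixed-0 : Fixed 0#
  Fixed-0 = Fixed-resp ι-0 (ι-fixed F.0#)

  Fixed-1 : Fixed 1#
  Fixed-1 = Fixed-resp ι-1 (ι-fixed F.1#)

  Fixed-neg : ∀ {x} → Fixed x → Fixed (- x)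
  Fixed-neg {x} fx = inverseˡ-unique (φ (- x)) x (begin
    φ (- x) + x    ≈⟨ +-congˡ fx ⟨
    φ (- x) + φ x  ≈⟨ φ-+ (- x) x ⟨
    φ (- x + x)    ≈⟨ φ-cong (-‿inverseˡ x) ⟩
    φ 0#           ≈⟨ Fixed-0 ⟩
    0#             ∎)

  -- Trace and norm from K to 𝔽_q.

  Tr≈ : ∀ x → Tr x ≈ x + φ x + φ (φ x) + φ (φ (φ x)) + φ (φ (φ (φ x)))
  Tr≈ x = +-cong (+-cong (+-congˡ (^q^2 x)) (^q^3 x)) (^q^4 x)

  private
    φ-+₅ : ∀ a b c d e → φ (a + b + c + d + e) ≈ φ a + φ b + φ c + φ d + φ e
    φ-+₅ a b c d e = trans (φ-+ _ e) (+-congʳ (trans (φ-+ _ d) (+-congʳ (trans (φ-+ _ c) (+-congʳ (φ-+ a b))))))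

  Tr-cong : ∀ {x y} → x ≈ y → Tr x ≈ Tr y
  Tr-cong x≈y = +-cong (+-cong (+-cong (+-cong x≈y (φ-cong x≈y)) (^-congˡ (q ℕ.^ 2) x≈y))
    (^-congˡ (q ℕ.^ 3) x≈y)) (^-congˡ (q ℕ.^ 4) x≈y)

  -- φ permutes the five conjugates of x cyclically.
  Tr-φ : ∀ x → Tr (φ x) ≈ Tr x
  Tr-φ x = begin
    Tr (φ x)                   ≈⟨ Tr≈ (φ x) ⟩
    b + c + d + e + φ e        ≈⟨ +-congˡ (φ⁵≈id x) ⟩
    b + c + d + e + x
      ≈⟨ solve 5 (λ x b c d e → b :+ c :+ d :+ e :+ x := x :+ b :+ c :+ d :+ e) refl x b c d e ⟩
    x + b + c + d + e          ≈⟨ Tr≈ x ⟨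
    Tr x                       ∎
    where
    b = φ x
    c = φ b
    d = φ c
    e = φ d

  Tr-fixed : ∀ x → Fixed (Tr x)
  Tr-fixed x = begin
    φ (Tr x)                                    ≈⟨ φ-cong (Tr≈ x) ⟩
    φ (x + b + c + d + e)                       ≈⟨ φ-+₅ x b c d e ⟩
    φ x + φ b + φ c + φ d + φ e                 ≈⟨ Tr≈ (φ x) ⟨
    Tr (φ x)                                    ≈⟨ Tr-φ x ⟩
    Tr x                                        ∎
    where
    b = φ x
    c = φ b
    d = φ c
    e = φ d

  Tr-+ : ∀ x y → Tr (x + y) ≈ Tr x + Tr y
  Tr-+ x y = begin
    Tr (x + y)
      ≈⟨ Tr≈ (x + y) ⟩
    (x + y) + φ (x + y) + φ (φ (x + y)) + φ (φ (φ (x + y))) + φ (φ (φ (φ (x + y))))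
      ≈⟨ +-cong (+-cong (+-cong (+-congˡ φ¹) φ²) φ³) (trans (φ-cong φ³) (φ-+ _ _)) ⟩
    (x + y) + (φ x + φ y) + (φ (φ x) + φ (φ y)) + (φ (φ (φ x)) + φ (φ (φ y))) + (φ (φ (φ (φ x))) + φ (φ (φ (φ y))))
      ≈⟨ solve 10 (λ a b c d e a′ b′ c′ d′ e′ →
           (a :+ a′) :+ (b :+ b′) :+ (c :+ c′) :+ (d :+ d′) :+ (e :+ e′)
           := (a :+ b :+ c :+ d :+ e) :+ (a′ :+ b′ :+ c′ :+ d′ :+ e′)) refl
           x (φ x) (φ (φ x)) (φ (φ (φ x))) (φ (φ (φ (φ x)))) y (φ y) (φ (φ y)) (φ (φ (φ y))) (φ (φ (φ (φ y)))) ⟩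
    _ ≈⟨ +-cong (Tr≈ x) (Tr≈ y) ⟨
    Tr x + Tr y ∎
    where
    φ¹ = φ-+ x y
    φ² = trans (φ-cong φ¹) (φ-+ _ _)
    φ³ = trans (φ-cong φ²) (φ-+ _ _)

  Tr-*ˡ : ∀ {a} → Fixed a → ∀ x → Tr (a * x) ≈ a * Tr x
  Tr-*ˡ {a} fa x = begin
    Tr (a * x)
      ≈⟨ Tr≈ (a * x) ⟩
    a * x + φ (a * x) + φ (φ (a * x)) + φ (φ (φ (a * x))) + φ (φ (φ (φ (a * x))))
      ≈⟨ +-cong (+-cong (+-cong (+-congˡ φ¹) φ²) φ³) (trans (φ-cong φ³) (φ-a* _)) ⟩
    a * x + a * φ x + a * φ (φ x) + a * φ (φ (φ x)) + a * φ (φ (φ (φ x)))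
      ≈⟨ solve 6 (λ a b c d e f →
           a :* b :+ a :* c :+ a :* d :+ a :* e :+ a :* f
           := a :* (b :+ c :+ d :+ e :+ f)) refl
           a x (φ x) (φ (φ x)) (φ (φ (φ x))) (φ (φ (φ (φ x)))) ⟩
    _ ≈⟨ *-congˡ (Tr≈ x) ⟨
    a * Tr x ∎
    where
    φ-a* : ∀ y → φ (a * y) ≈ a * φ y
    φ-a* y = trans (φ-* a y) (*-congʳ fa)
    φ¹ = φ-a* x
    φ² = trans (φ-cong φ¹) (φ-a* _)
    φ³ = trans (φ-cong φ²) (φ-a* _)

  N-fixed : ∀ x → Fixed (N x)
  N-fixed x = begin
    φ (N x)                          ≈⟨ φ-cong (N≈ x) ⟩
    φ (x * (b * c * d * e))          ≈⟨ φ-*₅ ⟩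
    b * (c * d * e * φ e)            ≈⟨ *-congˡ (*-congˡ (φ⁵≈id x)) ⟩
    b * (c * d * e * x)
      ≈⟨ solve 5 (λ x b c d e → b :* (c :* d :* e :* x) := x :* (b :* c :* d :* e)) refl x b c d e ⟩
    x * (b * c * d * e)              ≈⟨ N≈ x ⟨
    N x                              ∎
    where
    b = φ x
    c = φ b
    d = φ c
    e = φ d

    φ-*₅ : φ (x * (b * c * d * e)) ≈ b * (c * d * e * φ e)
    φ-*₅ = trans (φ-* x _) (*-congˡ (trans (φ-* _ e) (*-congʳ (trans (φ-* _ d) (*-congʳ (φ-* b c))))))

    N≈ : ∀ x → N x ≈ x * (φ x * φ (φ x) * φ (φ (φ x)) * φ (φ (φ (φ x))))
    N≈ x = *-congˡ (begin
      x ^ (q ℕ.+ q ℕ.^ 2 ℕ.+ q ℕ.^ 3 ℕ.+ q ℕ.^ 4)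
        ≈⟨ ^-homo-* x (q ℕ.+ q ℕ.^ 2 ℕ.+ q ℕ.^ 3) (q ℕ.^ 4) ⟩
      x ^ (q ℕ.+ q ℕ.^ 2 ℕ.+ q ℕ.^ 3) * x ^ (q ℕ.^ 4)
        ≈⟨ *-cong (trans (^-homo-* x (q ℕ.+ q ℕ.^ 2) (q ℕ.^ 3))
                         (*-cong (trans (^-homo-* x q (q ℕ.^ 2)) (*-congˡ (^q^2 x))) (^q^3 x))) (^q^4 x) ⟩
      φ x * φ (φ x) * φ (φ (φ x)) * φ (φ (φ (φ x))) ∎)

-- Construction of a vector u with both u and θ u in the subspace.

module WeightTwo
  {c₁ ℓ₁ c₂ ℓ₂ : Level} (q : ℕ) (primePower : PrimePower q)
  (F : FiniteField q c₁ ℓ₁) (K : FiniteField (q ℕ.^ 5) c₂ ℓ₂) (E : Embedding F K) where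

  open FiniteField K hiding (zero)
  open FiniteFieldProperties K
  open FrobeniusProperties q primePower F K E
  open LinearSets q F K E
    using (ι; Tr; N; Carrierᴹ; _≈ᴹ_; _*ₗ_; combination; LinearlyIndependent; Span; W; HasPointOfWeightTwo)
  open CommutativeSemiringExp commutativeSemiring using (_^_)
  open GroupProperties +-group using (∙-cancelˡ)
  open SemiringMult semiring using () renaming (_×_ to _·_)
  open SetoidReasoning setoid
  open SemiringSolver commutativeSemiring using (solve; _:+_; _:*_; _:=_; con)

  -- Identifies a negative through its sum with a common element, so that `Tr-θx` below reduces to a
  -- subtraction-free identity.
  +-complement-unique : ∀ {x y z} → x + y ≈ 0# → x + z ≈ 0# → y ≈ z
  +-complement-unique {x} x+y≈0 x+z≈0 = ∙-cancelˡ x _ _ (trans x+y≈0 (sym x+z≈0))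

  δ : Carrier → Carrier
  δ θ = φ θ - θ

  φ≈θ+δ : ∀ θ → φ θ ≈ θ + δ θ
  φ≈θ+δ θ = sym (begin
    θ + (φ θ - θ)    ≈⟨ +-comm _ _ ⟩
    φ θ - θ + θ      ≈⟨ +-assoc _ _ _ ⟩
    φ θ + (- θ + θ)  ≈⟨ +-congˡ (-‿inverseˡ θ) ⟩
    φ θ + 0#         ≈⟨ +-identityʳ _ ⟩
    φ θ              ∎)

  δ≉0 : ∀ {θ} → ¬ Fixed θ → ¬ (δ θ ≈ 0#)
  δ≉0 {θ} θ-moved δ≈0 = θ-moved (trans (φ≈θ+δ θ) (trans (+-congˡ δ≈0) (+-identityʳ θ)))

  -- Applying φ to a θ + b = 0 and comparing with the original equation gives δ a = 0, where δ is
  -- nonzero because θ is not fixed.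
  θ,1-independent : ∀ {θ} → ¬ Fixed θ → ∀ {a b} → Fixed a → Fixed b →
                    a * θ + b ≈ 0# → a ≈ 0# × b ≈ 0#
  θ,1-independent {θ} θ-moved {a} {b} fa fb aθ+b≈0 = a≈0 , b≈0
    where
    a≈0 : a ≈ 0#
    a≈0 = x*y≈0⇒y≈0 (δ≉0 θ-moved) (begin
      δ θ * a                  ≈⟨ +-identityʳ _ ⟨
      δ θ * a + 0#             ≈⟨ +-congˡ aθ+b≈0 ⟨
      δ θ * a + (a * θ + b)
        ≈⟨ solve 4 (λ d a t b → d :* a :+ (a :* t :+ b) := a :* (t :+ d) :+ b) refl (δ θ) a θ b ⟩
      a * (θ + δ θ) + b        ≈⟨ +-cong (*-cong fa (φ≈θ+δ θ)) fb ⟨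
      φ a * φ θ + φ b          ≈⟨ +-congʳ (φ-* a θ) ⟨
      φ (a * θ) + φ b          ≈⟨ φ-+ (a * θ) b ⟨
      φ (a * θ + b)            ≈⟨ φ-cong aθ+b≈0 ⟩
      φ 0#                     ≈⟨ Fixed-0 ⟩
      0#                       ∎)
    b≈0 : b ≈ 0#
    b≈0 = begin
      b           ≈⟨ +-identityˡ b ⟨
      0# + b      ≈⟨ +-congʳ (trans (*-congʳ a≈0) (zeroˡ θ)) ⟨
      a * θ + b   ≈⟨ aθ+b≈0 ⟩
      0#          ∎

  -- Here e is ε as an element of K.  The vectors u = (x , φ x + γ h) and θ u = (θ x , φ (θ x) + γ h′)
  -- both lie in W ε γ.
  record Pencil (γ θ e : Carrier) : Set (c₂ ⊔ ℓ₂) where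
    field
      x h h′    : Carrier
      x≉0       : ¬ (x ≈ 0#)
      h-fixed   : Fixed h
      h′-fixed  : Fixed h′
      Tr-x      : Tr x ≈ e * h
      Tr-θx     : Tr (θ * x) ≈ e * h′
      collinear : φ θ * φ x + γ * h′ ≈ θ * (φ x + γ * h)
      h,h′≉0    : ¬ (h ≈ 0# × h′ ≈ 0#)

  -- The pair (-B , A) always solves the equation. It could be zero when A = 0, and then (1 , 0) is
  -- taken instead.
  linear-form-zero : ∀ {A B} → Fixed A → Fixed B →
    ∃[ a ] ∃[ b ] (Fixed a × Fixed b × ¬ (a ≈ 0# × b ≈ 0#) × a * A + b * B ≈ 0#)
  linear-form-zero {A} {B} fA fB with A ≟ 0#
  ... | yes A≈0 = 1# , 0# , Fixed-1 , Fixed-0 , (λ (1≈0 , _) → 1≉0 1≈0) , (begin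
    1# * A + 0# * B  ≈⟨ +-cong (*-identityˡ A) (zeroˡ B) ⟩
    A + 0#           ≈⟨ +-identityʳ A ⟩
    A                ≈⟨ A≈0 ⟩
    0#               ∎)
  ... | no  A≉0 = - B , A , Fixed-neg fB , fA , (λ (_ , A≈0) → A≉0 A≈0) , (begin
    - B * A + A * B  ≈⟨ +-congˡ (*-comm A B) ⟩
    - B * A + B * A  ≈⟨ distribʳ A (- B) B ⟨
    (- B + B) * A    ≈⟨ *-congʳ (-‿inverseˡ B) ⟩
    0# * A           ≈⟨ zeroˡ A ⟩
    0#               ∎)

  -- With δ = θ^q - θ and D = N(δ)/δ, collinearity forces φ x = γ (θ h - h′) / δ, so x is determined
  -- by a = h / N(δ) and b = - h′ / N(δ).  The hypotheses on traces make Tr x = e h automatic, and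
  -- Tr (θ x) = e h′ becomes a single linear equation in (a , b) over 𝔽_q.
  pencil : ∀ {γ θ e} → ¬ (γ ≈ 0#) → ¬ Fixed θ → Fixed e →
           let D = δ θ ^ (q ℕ.+ q ℕ.^ 2 ℕ.+ q ℕ.^ 3 ℕ.+ q ℕ.^ 4) in
           Tr (γ * D) ≈ 0# → Tr (γ * θ * D) ≈ e * N (δ θ) → Pencil γ θ e
  pencil {γ} {θ} {e} γ≉0 θ-moved e-fixed Tr-γD Tr-γθD = record
    { x         = x
    ; h         = n * a
    ; h′        = - (n * b)
    ; x≉0       = x≉0
    ; h-fixed   = Fixed-* n-fixed a-fixed
    ; h′-fixed  = Fixed-neg (Fixed-* n-fixed b-fixed)
    ; Tr-x      = Tr-x
    ; Tr-θx     = Tr-θx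
    ; collinear = collinear
    ; h,h′≉0    = λ (h≈0 , h′≈0) → a,b≉0 (x*y≈0⇒y≈0 n≉0 h≈0 ,
        x*y≈0⇒y≈0 n≉0 (trans (sym (+-identityʳ _)) (trans (+-congˡ (sym h′≈0)) (-‿inverseʳ _))))
    }
    where
    D = δ θ ^ (q ℕ.+ q ℕ.^ 2 ℕ.+ q ℕ.^ 3 ℕ.+ q ℕ.^ 4)
    n = N (δ θ)

    n-fixed : Fixed n
    n-fixed = N-fixed (δ θ)

    D≉0 : ¬ (D ≈ 0#)
    D≉0 = ^-≉0 (q ℕ.+ q ℕ.^ 2 ℕ.+ q ℕ.^ 3 ℕ.+ q ℕ.^ 4) (δ≉0 θ-moved)

    n≉0 : ¬ (n ≈ 0#)
    -- The exponent of the norm starts with 1, so `n` unfolds to `δ θ * D`; the computations below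
    -- rely on this.
    n≉0 = *-≉0 (δ≉0 θ-moved) D≉0

    -- `A` and `B` are the coefficients of a and b in Tr (θ x) - e h′. In `B`, one e comes from Tr
    -- (γ θ D) = e n and the other from h′ = -n b.
    A = Tr (γ * D * (θ * φ θ))
    B = n * (e + e + Tr γ)

    solution = linear-form-zero {A} {B} (Tr-fixed _)
      (Fixed-* n-fixed (Fixed-+ (Fixed-+ e-fixed e-fixed) (Tr-fixed γ)))
    a = proj₁ solution
    b = proj₁ (proj₂ solution)
    a-fixed : Fixed a
    a-fixed = proj₁ (proj₂ (proj₂ solution))
    b-fixed : Fixed b
    b-fixed = proj₁ (proj₂ (proj₂ (proj₂ solution)))
    a,b≉0 : ¬ (a ≈ 0# × b ≈ 0#)
    a,b≉0 = proj₁ (proj₂ (proj₂ (proj₂ (proj₂ solution))))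
    aA+bB≈0 : a * A + b * B ≈ 0#
    aA+bB≈0 = proj₂ (proj₂ (proj₂ (proj₂ (proj₂ solution))))

    X = γ * D * (a * θ + b)
    -- The fourth iterate of φ inverts φ, so this is the x with φ x = X.
    x = φ (φ (φ (φ X)))

    φx≈X : φ x ≈ X
    φx≈X = φ⁵≈id X

    x≉0 : ¬ (x ≈ 0#)
    x≉0 = φ-≉0 (φ-≉0 (φ-≉0 (φ-≉0
      (*-≉0 (*-≉0 γ≉0 D≉0) (a,b≉0 ∘ θ,1-independent θ-moved a-fixed b-fixed)))))

    Tr-x : Tr x ≈ e * (n * a)
    Tr-x = begin
      Tr x                                    ≈⟨ Tr-φ x ⟨
      Tr (φ x)                                ≈⟨ Tr-cong φx≈X ⟩
      Tr X
        ≈⟨ Tr-cong (solve 5 (λ g d a t b → g :* d :* (a :* t :+ b)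
             := a :* (g :* t :* d) :+ b :* (g :* d)) refl γ D a θ b) ⟩
      Tr (a * (γ * θ * D) + b * (γ * D))      ≈⟨ Tr-+ _ _ ⟩
      Tr (a * (γ * θ * D)) + Tr (b * (γ * D)) ≈⟨ +-cong (Tr-*ˡ a-fixed _) (Tr-*ˡ b-fixed _) ⟩
      a * Tr (γ * θ * D) + b * Tr (γ * D)     ≈⟨ +-cong (*-congˡ Tr-γθD) (*-congˡ Tr-γD) ⟩
      a * (e * n) + b * 0#
        ≈⟨ solve 4 (λ a e n b → a :* (e :* n) :+ b :* con 0 := e :* (n :* a)) refl a e n b ⟩
      e * (n * a)                             ∎

    -- Replacing φ θ by θ + δ in the b-term and using δ D = n splits the expression into pieces
    -- whose traces are `A`, e n and Tr γ, up to factors in 𝔽_q.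
    φθX : φ θ * X ≈ a * (γ * D * (θ * φ θ)) + b * (γ * θ * D) + n * b * γ
    φθX = begin
      φ θ * X
        ≈⟨ solve 6 (λ p g d a t b → p :* (g :* d :* (a :* t :+ b))
             := a :* (g :* d :* (t :* p)) :+ b :* g :* d :* p) refl (φ θ) γ D a θ b ⟩
      a * (γ * D * (θ * φ θ)) + b * γ * D * φ θ
        ≈⟨ +-congˡ (*-congˡ (φ≈θ+δ θ)) ⟩
      a * (γ * D * (θ * φ θ)) + b * γ * D * (θ + δ θ)
        ≈⟨ solve 6 (λ r b g d t s → r :+ b :* g :* d :* (t :+ s)
             := r :+ b :* (g :* t :* d) :+ s :* d :* b :* g) refl (a * (γ * D * (θ * φ θ))) b γ D θ (δ θ) ⟩
      a * (γ * D * (θ * φ θ)) + b * (γ * θ * D) + n * b * γ ∎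

    Tr-θx : Tr (θ * x) ≈ e * - (n * b)
    Tr-θx = begin
      Tr (θ * x)                                        ≈⟨ Tr-φ _ ⟨
      Tr (φ (θ * x))
        ≈⟨ Tr-cong (trans (φ-* θ x) (trans (*-congˡ φx≈X) φθX)) ⟩
      Tr (a * (γ * D * (θ * φ θ)) + b * (γ * θ * D) + n * b * γ)
        ≈⟨ trans (Tr-+ _ _) (+-cong (trans (Tr-+ _ _) (+-cong (Tr-*ˡ a-fixed _) (Tr-*ˡ b-fixed _))) (Tr-*ˡ (Fixed-* n-fixed b-fixed) γ)) ⟩
      a * A + b * Tr (γ * θ * D) + n * b * Tr γ         ≈⟨ +-congʳ (+-congˡ (*-congˡ Tr-γθD)) ⟩
      a * A + b * (e * n) + n * b * Tr γ
        -- Both sides add up to 0 with e (n b): the left one by the choice of a and b.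
        ≈⟨ +-complement-unique total (trans (sym (distribˡ e _ _)) (trans (*-congˡ (-‿inverseʳ _)) (zeroʳ e))) ⟩
      e * - (n * b)                                     ∎
      where
      total : e * (n * b) + (a * A + b * (e * n) + n * b * Tr γ) ≈ 0#
      total = trans
        (solve 5 (λ e n b r t → e :* (n :* b) :+ (r :+ b :* (e :* n) :+ n :* b :* t)
           := r :+ b :* (n :* (e :+ e :+ t))) refl e n b (a * A) (Tr γ))
        aA+bB≈0

    collinear : φ θ * φ x + γ * - (n * b) ≈ θ * (φ x + γ * (n * a))
    collinear = begin
      φ θ * φ x + γ * - (n * b)
        ≈⟨ +-congʳ (*-cong (φ≈θ+δ θ) φx≈X) ⟩
      (θ + δ θ) * X + γ * - (n * b)
        ≈⟨ trans (+-congʳ (distribʳ X θ (δ θ))) (+-assoc _ _ _) ⟩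
      θ * X + (δ θ * X + γ * - (n * b))
        ≈⟨ +-congˡ (solve 7 (λ t s g d a b w →
             s :* (g :* d :* (a :* t :+ b)) :+ g :* w
             := t :* (g :* (s :* d :* a)) :+ g :* (s :* d :* b :+ w)) refl θ (δ θ) γ D a b (- (n * b))) ⟩
      θ * X + (θ * (γ * (n * a)) + γ * (n * b - n * b))
        ≈⟨ +-congˡ (+-congˡ (trans (*-congˡ (-‿inverseʳ _)) (zeroʳ γ))) ⟩
      θ * X + (θ * (γ * (n * a)) + 0#)
        ≈⟨ +-congˡ (+-identityʳ _) ⟩
      θ * X + θ * (γ * (n * a))
        ≈⟨ distribˡ θ _ _ ⟨
      θ * (X + γ * (n * a))
        ≈⟨ *-congˡ (+-congʳ φx≈X) ⟨
      θ * (φ x + γ * (n * a)) ∎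

  -- The multiples of u that lie in the subspace.

  module _ {γ θ e : Carrier} (θ-moved : ¬ Fixed θ) (P : Pencil γ θ e) where
    open Pencil P

    m : Carrier
    m = φ x + γ * h

    u : Carrierᴹ
    u = x , m

    -- Says that k u = (k x , φ (k x) + γ g).
    OnLine : Carrier → Carrier → Set ℓ₂
    OnLine k g = φ k * φ x + γ * g ≈ k * m

    OnLine-1 : OnLine 1# h
    OnLine-1 = trans (+-congʳ (trans (*-congʳ Fixed-1) (*-identityˡ _))) (sym (*-identityˡ m))

    OnLine-+ : ∀ {k l g j} → OnLine k g → OnLine l j → OnLine (k + l) (g + j)
    OnLine-+ {k} {l} {g} {j} ok ol = begin
      φ (k + l) * φ x + γ * (g + j)                ≈⟨ +-congʳ (*-congʳ (φ-+ k l)) ⟩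
      (φ k + φ l) * φ x + γ * (g + j)
        ≈⟨ solve 6 (λ k l X c g j → (k :+ l) :* X :+ c :* (g :+ j)
             := (k :* X :+ c :* g) :+ (l :* X :+ c :* j)) refl (φ k) (φ l) (φ x) γ g j ⟩
      (φ k * φ x + γ * g) + (φ l * φ x + γ * j)    ≈⟨ +-cong ok ol ⟩
      k * m + l * m                                ≈⟨ distribʳ m k l ⟨
      (k + l) * m                                  ∎

    OnLine-* : ∀ {a k g} → Fixed a → OnLine k g → OnLine (a * k) (a * g)
    OnLine-* {a} {k} {g} fa ok = begin
      φ (a * k) * φ x + γ * (a * g)  ≈⟨ +-congʳ (*-congʳ (trans (φ-* a k) (*-congʳ fa))) ⟩
      a * φ k * φ x + γ * (a * g)
        ≈⟨ solve 5 (λ a k X c g → a :* k :* X :+ c :* (a :* g)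
             := a :* (k :* X :+ c :* g)) refl a (φ k) (φ x) γ g ⟩
      a * (φ k * φ x + γ * g)        ≈⟨ *-congˡ ok ⟩
      a * (k * m)                    ≈⟨ *-assoc a k m ⟨
      a * k * m                      ∎

    -- `collinear` is `OnLine θ h′`, so the relation holds at 1 and at θ, and it is 𝔽_q-linear in
    -- the pair (k , g).
    OnLine-combination : ∀ {s t} → Fixed s → Fixed t → OnLine (s + t * θ) (s * h + t * h′)
    OnLine-combination {s} {t} fs ft = begin
      φ (s + t * θ) * φ x + γ * (s * h + t * h′)       ≈⟨ +-congʳ (*-congʳ (φ-cong s≈)) ⟨
      φ (s * 1# + t * θ) * φ x + γ * (s * h + t * h′)
        ≈⟨ OnLine-+ (OnLine-* fs OnLine-1) (OnLine-* ft collinear) ⟩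
      (s * 1# + t * θ) * m                             ≈⟨ *-congʳ s≈ ⟩
      (s + t * θ) * m                                  ∎
      where
      s≈ : s * 1# + t * θ ≈ s + t * θ
      s≈ = +-congʳ (*-identityʳ s)

    -- For g = 0 the relation says φ (k x) / (k x) = m / x, independently of k.
    OnLine-0-proportional : ∀ {k z g j} → g ≈ 0# → j ≈ 0# → OnLine k g → OnLine z j → ¬ (z ≈ 0#) →
                            ∃[ f ] (Fixed f × k ≈ f * z)
    OnLine-0-proportional {k} {z} g≈0 j≈0 ok oz z≉0 with z⁻¹ , zz⁻¹≈1 ← inverse z z≉0 =
      f , *-cancelˡ-≉0 (*-≉0 z≉0 (φ-≉0 z≉0)) φf≈f , k≈fz
      where
      f = k * z⁻¹
      k≈fz : k ≈ f * z
      k≈fz = sym (trans (solve 3 (λ k w z → k :* w :* z := z :* w :* k) refl k z⁻¹ z)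
                        (trans (*-congʳ zz⁻¹≈1) (*-identityˡ k)))

      eigen : ∀ {k g} → g ≈ 0# → OnLine k g → φ k * φ x ≈ k * m
      eigen g≈0 ok = trans (sym (+-identityʳ _))
        (trans (+-congˡ (sym (trans (*-congˡ g≈0) (zeroʳ γ)))) ok)

      φkz≈kφz : φ k * z ≈ k * φ z
      φkz≈kφz = *-cancelˡ-≉0 (φ-≉0 x≉0) (begin
        φ x * (φ k * z)  ≈⟨ solve 3 (λ X a z → X :* (a :* z) := a :* X :* z) refl (φ x) (φ k) z ⟩
        φ k * φ x * z    ≈⟨ *-congʳ (eigen g≈0 ok) ⟩
        k * m * z        ≈⟨ solve 3 (λ k m z → k :* m :* z := k :* (z :* m)) refl k m z ⟩
        k * (z * m)      ≈⟨ *-congˡ (eigen j≈0 oz) ⟨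
        k * (φ z * φ x)  ≈⟨ solve 3 (λ k a X → k :* (a :* X) := X :* (k :* a)) refl k (φ z) (φ x) ⟩
        φ x * (k * φ z)  ∎)

      φf≈f : z * φ z * φ f ≈ z * φ z * f
      φf≈f = begin
        z * φ z * φ f    ≈⟨ solve 3 (λ z a b → z :* a :* b := b :* a :* z) refl z (φ z) (φ f) ⟩
        φ f * φ z * z    ≈⟨ *-congʳ (φ-* f z) ⟨
        φ (f * z) * z    ≈⟨ *-congʳ (φ-cong k≈fz) ⟨
        φ k * z          ≈⟨ φkz≈kφz ⟩
        k * φ z          ≈⟨ *-congʳ k≈fz ⟩
        f * z * φ z      ≈⟨ solve 3 (λ f z a → f :* z :* a := z :* a :* f) refl f z (φ z) ⟩
        z * φ z * f      ∎

    -- Provides a multiplier a + b θ with parameter 1; its g-fold can be subtracted from a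
    -- multiplier with parameter g to make the parameter vanish.
    bezout : ∃[ a ] ∃[ b ] (Fixed a × Fixed b × a * h + b * h′ ≈ 1#)
    bezout with h ≟ 0#
    ... | no h≉0 = let w , hw≈1 = inverse h h≉0 in
      w , 0# , Fixed-cofactor h≉0 h-fixed (Fixed-resp (sym hw≈1) Fixed-1) , Fixed-0 ,
      trans (+-cong (trans (*-comm w h) hw≈1) (zeroˡ h′)) (+-identityʳ 1#)
    ... | yes h≈0 = let h′≉0 = λ h′≈0 → h,h′≉0 (h≈0 , h′≈0)
                        w , h′w≈1 = inverse h′ h′≉0 in
      0# , w , Fixed-0 , Fixed-cofactor h′≉0 h′-fixed (Fixed-resp (sym h′w≈1) Fixed-1) ,
      trans (+-cong (zeroˡ h) (trans (*-comm w h′) h′w≈1)) (+-identityˡ 1#)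

    -- The weight is at most two: subtracting a combination of 1 and θ brings g to 0, and the
    -- multipliers with g = 0 form the 𝔽_q-line through z = h θ - h′.
    OnLine⇒combination : ∀ {k g} → Fixed g → OnLine k g →
                         ∃[ s ] ∃[ t ] (Fixed s × Fixed t × k ≈ s + t * θ)
    OnLine⇒combination {k} {g} g-fixed ok =
      let a , b , fa , fb , ah+bh′≈1 = bezout in reduce fa fb ah+bh′≈1
      where
      reduce : ∀ {a b} → Fixed a → Fixed b → a * h + b * h′ ≈ 1# →
               ∃[ s ] ∃[ t ] (Fixed s × Fixed t × k ≈ s + t * θ)
      reduce {a} {b} fa fb ah+bh′≈1 =
        let f , ff , k′≈fz = OnLine-0-proportional g′≈0 j≈0
              (OnLine-+ ok (OnLine-combination (Fixed-* (Fixed-neg g-fixed) fa) (Fixed-* (Fixed-neg g-fixed) fb)))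
              (OnLine-combination (Fixed-neg h′-fixed) h-fixed)
              z≉0
        -- Adding g (a + b θ) back to f z gives the coordinates of k with respect to 1 and θ.
        in f * - h′ + g * a , f * h + g * b ,
           Fixed-+ (Fixed-* ff (Fixed-neg h′-fixed)) (Fixed-* g-fixed fa) ,
           Fixed-+ (Fixed-* ff h-fixed) (Fixed-* g-fixed fb) ,
           (begin
             k
               ≈⟨ restore ⟩
             k + (- g * a + - g * b * θ) + (g * a + g * b * θ)
               ≈⟨ +-congʳ k′≈fz ⟩
             f * (- h′ + h * θ) + (g * a + g * b * θ)
               ≈⟨ solve 7 (λ f w h t g a b → f :* (w :+ h :* t) :+ (g :* a :+ g :* b :* t)
                    := (f :* w :+ g :* a) :+ (f :* h :+ g :* b) :* t) refl f (- h′) h θ g a b ⟩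
             (f * - h′ + g * a) + (f * h + g * b) * θ ∎)
        where
        g′≈0 : g + (- g * a * h + - g * b * h′) ≈ 0#
        g′≈0 = begin
          g + (- g * a * h + - g * b * h′)
            ≈⟨ +-congˡ (solve 5 (λ n a h b k → n :* a :* h :+ n :* b :* k
                 := n :* (a :* h :+ b :* k)) refl (- g) a h b h′) ⟩
          g + - g * (a * h + b * h′)        ≈⟨ +-congˡ (trans (*-congˡ ah+bh′≈1) (*-identityʳ _)) ⟩
          g + - g                           ≈⟨ -‿inverseʳ g ⟩
          0#                                ∎

        j≈0 : - h′ * h + h * h′ ≈ 0#
        j≈0 = begin
          - h′ * h + h * h′  ≈⟨ +-congˡ (*-comm h h′) ⟩
          - h′ * h + h′ * h  ≈⟨ distribʳ h (- h′) h′ ⟨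
          (- h′ + h′) * h    ≈⟨ *-congʳ (-‿inverseˡ h′) ⟩
          0# * h             ≈⟨ zeroˡ h ⟩
          0#                 ∎

        z≉0 : ¬ (- h′ + h * θ ≈ 0#)
        z≉0 z≈0 = h,h′≉0 (h≈0 , h′≈0)
          where
          both : h ≈ 0# × - h′ ≈ 0#
          both = θ,1-independent θ-moved h-fixed (Fixed-neg h′-fixed) (trans (+-comm _ _) z≈0)
          h≈0 = proj₁ both
          h′≈0 : h′ ≈ 0#
          h′≈0 = trans (sym (+-identityʳ h′)) (trans (+-congˡ (sym (proj₂ both))) (-‿inverseʳ h′))

        restore : k ≈ k + (- g * a + - g * b * θ) + (g * a + g * b * θ)
        restore = sym (begin
          k + (- g * a + - g * b * θ) + (g * a + g * b * θ)
            ≈⟨ solve 6 (λ k n a b t g → k :+ (n :* a :+ n :* b :* t) :+ (g :* a :+ g :* b :* t)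
                 := k :+ (n :+ g) :* (a :+ b :* t)) refl k (- g) a b θ g ⟩
          k + (- g + g) * (a + b * θ)
            ≈⟨ +-congˡ (trans (*-congʳ (-‿inverseˡ g)) (zeroˡ _)) ⟩
          k + 0#
            ≈⟨ +-identityʳ k ⟩
          k ∎)

    basis : Vector Carrierᴹ 2
    basis zero       = u
    basis (suc zero) = θ *ₗ u

    combination-basis : ∀ a → combination a basis ≈ᴹ (ι (a zero) + ι (a (suc zero)) * θ) *ₗ u
    combination-basis a = component x , component m
      where
      component : ∀ y → ι (a zero) * y + (ι (a (suc zero)) * (θ * y) + 0#) ≈ (ι (a zero) + ι (a (suc zero)) * θ) * y
      component y = solve 4 (λ s t v y → s :* y :+ (t :* (v :* y) :+ con 0) := (s :+ t :* v) :* y) refl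
        (ι (a zero)) (ι (a (suc zero))) θ y

    basis-independent : LinearlyIndependent basis
    basis-independent a a·b≈0 = λ where
        zero       → ι-injective (trans (proj₂ both) (sym ι-0))
        (suc zero) → ι-injective (trans (proj₁ both) (sym ι-0))
      where
      both : ι (a (suc zero)) ≈ 0# × ι (a zero) ≈ 0#
      -- The first coordinate suffices: it is (s + t θ) x with x nonzero.
      both = θ,1-independent θ-moved (ι-fixed _) (ι-fixed _) (trans (+-comm _ _)
        (x*y≈0⇒y≈0 x≉0 (trans (*-comm x _)
          (trans (sym (proj₁ (combination-basis a))) (proj₁ a·b≈0)))))

  -- The point spanned by u has weight exactly two.

  W′ : Carrier → Carrier → Carrierᴹ → Set (c₂ ⊔ ℓ₂)
  W′ e γ v = Σ[ x ∈ Carrier ] Σ[ h ∈ Carrier ] (Fixed h × Tr x ≈ e * h × v ≈ᴹ (x , φ x + γ * h))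

  -- `W′` treats both values of ε at once: for e = 0 its trace condition reads Tr x = 0 and leaves h
  -- free in 𝔽_q, and for e = 1 it forces h = Tr x.
  W⇒W′ : ∀ ε γ {v} → W ε γ v → W′ (toℕ ε · 1#) γ v
  W⇒W′ zero       γ (x , h , Tr≈0 , h∈ , v≈) = x , h , ∈𝔽q⇒fixed h∈ , trans Tr≈0 (sym (zeroˡ h)) , v≈
  W⇒W′ (suc zero) γ (lift (x , v≈)) =
    x , Tr x , Tr-fixed x , sym (trans (*-congʳ (+-identityʳ 1#)) (*-identityˡ _)) , v≈

  W′⇒W : ∀ ε γ {v} → W′ (toℕ ε · 1#) γ v → W ε γ v
  W′⇒W zero       γ (x , h , fh , Tr≈ , v≈) = x , h , trans Tr≈ (zeroˡ h) , fixed⇒∈𝔽q fh , v≈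
  W′⇒W (suc zero) γ (x , h , fh , Tr≈ , v₁≈ , v₂≈) = lift (x , v₁≈ , trans v₂≈ (+-congˡ (*-congˡ h≈Tr)))
    where
    h≈Tr : h ≈ Tr x
    h≈Tr = sym (trans Tr≈ (trans (*-congʳ (+-identityʳ 1#)) (*-identityˡ h)))

  -- The basis consists of u and θ u. `inside` bounds the weight above by two; `outside` together
  -- with independence bounds it below.
  weightTwo : ∀ ε {γ θ} → ¬ Fixed θ → Pencil γ θ (toℕ ε · 1#) → HasPointOfWeightTwo (W ε γ)
  weightTwo ε {γ} {θ} θ-moved P =
    record { representative = v ; nonzero = x≉0 ∘ proj₁ } ,
    (v , W′⇒W ε γ (x , h , h-fixed , Tr-x , refl , refl) , x≉0 ∘ proj₁ , λ _ → mk⇔ (λ i → i) (λ i → i)) ,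
    basis θ-moved P , basis-independent θ-moved P , λ w → mk⇔ inside outside
    where
    open Pencil P
    v = u θ-moved P

    inside : ∀ {w} → W ε γ w × (Σ[ k ∈ Carrier ] w ≈ᴹ k *ₗ v) → Span (basis θ-moved P) w
    inside (w∈W , k , w₁≈kx , w₂≈km) =
      let y , g , g-fixed , _ , w₁≈y , w₂≈ = W⇒W′ ε γ w∈W
          -- Equating the two descriptions of w, as k u and as (y , φ y + γ g), yields `OnLine k g`.
          s , t , fs , ft , k≈ = OnLine⇒combination θ-moved P {k} g-fixed (begin
             φ k * φ x + γ * g  ≈⟨ +-congʳ (φ-* k x) ⟨
             φ (k * x) + γ * g  ≈⟨ +-congʳ (φ-cong (trans (sym w₁≈kx) w₁≈y)) ⟩
             φ y + γ * g        ≈⟨ trans (sym w₂≈) w₂≈km ⟩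
             k * m θ-moved P    ∎)
          a , s≈ = fixed⇒∈𝔽q fs
          b , t≈ = fixed⇒∈𝔽q ft
          coefficients = λ { zero → a ; (suc zero) → b }
          k≈ιa+ιbθ = trans k≈ (+-cong s≈ (*-congʳ t≈))
          combination₁ , combination₂ = combination-basis θ-moved P coefficients
      in coefficients ,
         trans w₁≈kx (trans (*-congʳ k≈ιa+ιbθ) (sym combination₁)) ,
         trans w₂≈km (trans (*-congʳ k≈ιa+ιbθ) (sym combination₂))

    outside : ∀ {w} → Span (basis θ-moved P) w → W ε γ w × (Σ[ k ∈ Carrier ] w ≈ᴹ k *ₗ v)
    outside {w} (a , w₁≈ , w₂≈) =
      W′⇒W ε γ (k * x , s * h + t * h′ ,
        Fixed-+ (Fixed-* fs h-fixed) (Fixed-* ft h′-fixed) , Tr-kx , w₁≈kx ,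
        trans w₂≈km (trans (sym (OnLine-combination θ-moved P fs ft)) (+-congʳ (sym (φ-* k x))))) ,
      k , w₁≈kx , w₂≈km
      where
      s = ι (a zero)
      t = ι (a (suc zero))
      fs : Fixed s
      fs = ι-fixed _
      ft : Fixed t
      ft = ι-fixed _
      k = s + t * θ
      w₁≈kx : proj₁ w ≈ k * x
      w₁≈kx = trans w₁≈ (proj₁ (combination-basis θ-moved P a))
      w₂≈km : proj₂ w ≈ k * m θ-moved P
      w₂≈km = trans w₂≈ (proj₂ (combination-basis θ-moved P a))
      e = toℕ ε · 1#
      Tr-kx : Tr (k * x) ≈ e * (s * h + t * h′)
      Tr-kx = begin
        Tr (k * x)                     ≈⟨ Tr-cong (trans (distribʳ x s (t * θ)) (+-congˡ (*-assoc t θ x))) ⟩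
        Tr (s * x + t * (θ * x))       ≈⟨ trans (Tr-+ _ _) (+-cong (Tr-*ˡ fs x) (Tr-*ˡ ft (θ * x))) ⟩
        s * Tr x + t * Tr (θ * x)      ≈⟨ +-cong (*-congˡ Tr-x) (*-congˡ Tr-θx) ⟩
        s * (e * h) + t * (e * h′)
          ≈⟨ solve 5 (λ s e h t k → s :* (e :* h) :+ t :* (e :* k)
               := e :* (s :* h :+ t :* k)) refl s e h t h′ ⟩
        e * (s * h + t * h′)           ∎

  natural-fixed : ∀ m → Fixed (m · 1#)
  natural-fixed zero    = Fixed-0
  natural-fixed (suc m) = Fixed-+ Fixed-1 (natural-fixed m)

theorem3p1 : {c₁ ℓ₁ c₂ ℓ₂ : Level} (q : ℕ) → PrimePower q →
    (F : FiniteField q c₁ ℓ₁) (K : FiniteField (q ℕ.^ 5) c₂ ℓ₂) (E : Embedding F K) →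
    let open LinearSets q F K E in
    (ε : Fin 2) (γ : Carrier) → ¬ (γ ≈ 0#) →
    (Σ[ θ ∈ Carrier ]
    ( ¬ (θ ∈𝔽q)
    × Tr (γ * (θ ^ q - θ) ^ (q ℕ.+ q ℕ.^ 2 ℕ.+ q ℕ.^ 3 ℕ.+ q ℕ.^ 4)) ≈ 0#
    × Tr (γ * θ * (θ ^ q - θ) ^ (q ℕ.+ q ℕ.^ 2 ℕ.+ q ℕ.^ 3 ℕ.+ q ℕ.^ 4)) ≈ toℕ ε · N (θ ^ q - θ))) →
    HasPointOfWeightTwo (W ε γ)
theorem3p1 q primePower F K E ε γ γ≉0 (θ , θ∉𝔽q , Tr-γD , Tr-γθD) =
  weightTwo ε θ-moved (pencil γ≉0 θ-moved (natural-fixed (toℕ ε)) Tr-γD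
    -- The natural multiple of the norm is rewritten as a product with the field element e.
    (trans Tr-γθD (sym (trans (×-assoc-* (toℕ ε) 1# _) (×-congʳ (toℕ ε) (*-identityˡ _))))))
  where
  open FiniteField K
  open FrobeniusProperties q primePower F K E using (Fixed; fixed⇒∈𝔽q)
  open WeightTwo q primePower F K E
  open SemiringMult semiring using (×-assoc-*; ×-congʳ)
  θ-moved : ¬ Fixed θ
  θ-moved = θ∉𝔽q ∘ fixed⇒∈𝔽q
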